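{- Let $\Sigma$ be a first-order language and let $\mathcal{T}_{\Sigma,\infty}$ be the family of all complete theories in $\Sigma$ having infinite models. If $\Sigma$ is finite and contains no predicate symbols of arity $m\ge 2$ and no function symbols of arity $n\ge 1$, then ${\rm RS}(\mathcal{T}_{\Sigma,\infty})$ is finite (a natural number); otherwise ${\rm RS}(\mathcal{T}_{\Sigma,\infty})=\infty$.
   Context: Theories are complete consistent first-order theories; structures have nonempty universes. Function symbols (constants being $0$-ary function symbols) are treated via their graphs: each $n$-ary function symbol $f$ is replaced by an $(n+1)$-ary predicate $R_f=\{(\bar a,b)\mid f(\bar a)=b\}$, and sentences are those of the resulting relational language. For a family $\mathcal{T}$ of theories and a sentence $\varphi$ of its language, $\mathcal{T}_\varphi=\{T\in\mathcal{T}\mid\varphi\in T\}$. The rank ${\rm RS}$ of a family is defined as follows: ${\rm RS}(\emptyset)=-1$; ${\rm RS}(\mathcal{T})=0$ for finite nonempty $\mathcal{T}$; ${\rm RS}(\mathcal{T})\ge 1$ for infinite $\mathcal{T}$; for $\alpha=\beta+1$, ${\rm RS}(\mathcal{T})\ge\alpha$ iff there are pairwise inconsistent sentences $\varphi_k$, $k\in\omega$, of the language of $\mathcal{T}$ with ${\rm RS}(\mathcal{T}_{\varphi_k})\ge\beta$ for all $k$; for limit $\alpha$, ${\rm RS}(\mathcal{T})\ge\alpha$ iff ${\rm RS}(\mathcal{T})\ge\beta$ for all $\beta<\alpha$; ${\rm RS}(\mathcal{T})=\alpha$ iff ${\rm RS}(\mathcal{T})\ge\alpha$ and not ${\rm RS}(\mathcal{T})\ge\alpha+1$;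 ${\rm RS}(\mathcal{T})=\infty$ if ${\rm RS}(\mathcal{T})\ge\alpha$ for every ordinal $\alpha$. -}

module Defs where

open import Data.Fin.Base using (Fin)
open import Data.List.Base using (List)
open import Data.List.Relation.Unary.Any using (Any)
open import Data.Nat.Base using (ℕ; zero; suc; _≤_)
open import Data.Product.Base using (Σ; ∃; ∃-syntax; _×_)
open import Data.Sum.Base using (_⊎_)
open import Data.Vec.Base using (Vec; []; _∷_; lookup; map)
open import Function.Bundles using (_↔_)
open import Level using (0ℓ) renaming (suc to lsuc)
open import Relation.Binary.PropositionalEquality.Core using (_≡_; _≢_)
open import Relation.Nullary.Negation.Core using (¬_)
open import Relation.Unary using (Pred; _∈_; _≐_)

Finite : Set → Set
Finite A = ∃[ n ] A ↔ Fin n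

Infinite : Set → Set
Infinite A = ¬ Finite A

-- Symbols are indexed by their arity; constants are the 0-ary functions.

record Language : Set₁ where
  field
    PredSym : ℕ → Set
    FunSym  : ℕ → Set

module _ (L : Language) where
  open Language L

  -- Formulas of the relational language with equality, in n de Bruijn
  -- variables. Function symbols occur only through their graphs:
  -- graph f xs y is the atom R_f(xs, y).

  data Formula (n : ℕ) : Set where
    equal  : (x y : Fin n) → Formula n
    rel    : ∀ {k} → PredSym k → Vec (Fin n) k → Formula n
    graph  : ∀ {k} → FunSym k → Vec (Fin n) k → Fin n → Formula n
    not    : Formula n → Formula n
    and    : Formula n → Formula n → Formula n
    exists : Formula (suc n) → Formula n

  Sentence : Set
  Sentence = Formula 0

  record Structure : Set₁ where
    field
      Carrier : Set
      point   : Carrier     -- universes are nonempty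
      relᴹ    : ∀ {k} → PredSym k → Vec Carrier k → Set
      funᴹ    : ∀ {k} → FunSym k → Vec Carrier k → Carrier

module _ {L : Language} where
  open Structure

  Holds : (M : Structure L) {n : ℕ} → Vec (Carrier M) n → Formula L n → Set
  Holds M ρ (equal x y)    = lookup ρ x ≡ lookup ρ y
  Holds M ρ (rel R xs)     = relᴹ M R (map (lookup ρ) xs)
  Holds M ρ (graph f xs y) = funᴹ M f (map (lookup ρ) xs) ≡ lookup ρ y
  Holds M ρ (not φ)        = ¬ Holds M ρ φ
  Holds M ρ (and φ ψ)      = Holds M ρ φ × Holds M ρ ψ
  Holds M ρ (exists φ)     = Σ (Carrier M) λ a → Holds M (a ∷ ρ) φ

  infix 4 _⊨_ _⊨ᵀ_

  _⊨_ : Structure L → Sentence L → Set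
  M ⊨ φ = Holds M [] φ

  _⊨ᵀ_ : Structure L → Pred (Sentence L) 0ℓ → Set
  M ⊨ᵀ Φ = ∀ φ → φ ∈ Φ → M ⊨ φ

  -- Consistency means having a model.

  Inconsistent : Sentence L → Sentence L → Set₁
  Inconsistent φ ψ = ¬ (∃[ M ] (M ⊨ φ) × (M ⊨ ψ))

-- Complete consistent theories. Closure under semantic consequence is
-- automatic: if φ is a consequence but not a member, then not φ is a
-- member, which contradicts consistency.

record Theory (L : Language) : Set₁ where
  field
    sentences     : Pred (Sentence L) 0ℓ
    consistent : ∃[ M ] M ⊨ᵀ sentences
    complete   : ∀ φ → φ ∈ sentences ⊎ not φ ∈ sentences

open Theory

Family : Language → Set₂
Family L = Pred (Theory L) (lsuc 0ℓ)

module _ {L : Language} where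

  _↾_ : Family L → Sentence L → Family L
  (𝒯 ↾ φ) T = T ∈ 𝒯 × φ ∈ sentences T

  NonemptyFamily : Family L → Set₁
  NonemptyFamily 𝒯 = ∃[ T ] T ∈ 𝒯

  -- Theories are sets of sentences, so they are counted up to _≐_.

  FiniteFamily : Family L → Set₁
  FiniteFamily 𝒯 =
    Σ (List (Theory L)) λ Ts → ∀ T → T ∈ 𝒯 → Any (λ T′ → sentences T ≐ sentences T′) Ts

  InfiniteFamily : Family L → Set₁
  InfiniteFamily 𝒯 = ¬ FiniteFamily 𝒯

-- Ordinals presented by zero, successor and suprema of families over an
-- arbitrary index type. The family must be inhabited, as otherwise
-- its supremum would be a second zero, at which the supremum clause of
-- _RS≥_ below would hold vacuously even for the empty family. Families
-- need not be increasing: "RS ≥ α" is antitone in α, so the clause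
-- "RS ≥ every member" is right even when the supremum is attained.

data Ordinal : Set₁ where
  zero : Ordinal
  suc  : Ordinal → Ordinal
  sup  : (I : Set) → I → (I → Ordinal) → Ordinal

fromℕ : ℕ → Ordinal
fromℕ zero    = zero
fromℕ (suc n) = suc (fromℕ n)

module _ {L : Language} where

  infix 4 _RS≥_ _RS≡_ _RS≡∞

  mutual
    _RS≥_ : Family L → Ordinal → Set₁
    𝒯 RS≥ zero             = NonemptyFamily 𝒯
    𝒯 RS≥ suc zero         = InfiniteFamily 𝒯
    𝒯 RS≥ suc (suc α)      = Splits 𝒯 (suc α)
    𝒯 RS≥ suc (sup I i₀ α) = Splits 𝒯 (sup I i₀ α)
    𝒯 RS≥ sup I i₀ α       = ∀ i → 𝒯 RS≥ α i

    Splits : Family L → Ordinal → Set₁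
    Splits 𝒯 β =
      Σ (ℕ → Sentence L) λ φ →
        (∀ k l → k ≢ l → Inconsistent (φ k) (φ l)) ×
        (∀ k → (𝒯 ↾ φ k) RS≥ β)

  _RS≡_ : Family L → Ordinal → Set₁
  𝒯 RS≡ α = (𝒯 RS≥ α) × ¬ (𝒯 RS≥ suc α)

  _RS≡∞ : Family L → Set₁
  𝒯 RS≡∞ = ∀ α → 𝒯 RS≥ α

𝒯∞ : (L : Language) → Family L
𝒯∞ L T = ∃[ M ] (M ⊨ᵀ sentences T) × Infinite (Structure.Carrier M)

FiniteMonadic : Language → Set
FiniteMonadic L =
  Finite (∃ PredSym ⊎ ∃ FunSym) ×
  ¬ (∃[ m ] 2 ≤ m × PredSym m) ×
  ¬ (∃[ n ] 1 ≤ n × FunSym n)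
  where open Language L

-- If infinite structures realise every truth pattern of a sequence of sentences ψᵢ, then any
-- family containing all patterns with a given finite prefix splits, by the position of the next
-- true ψᵢ, into infinitely many families of the same kind, so its rank is ∞. A symbol of positive
-- functional arity or of relational arity ≥ 2 encodes a function whose chains from leaves to
-- fixed points have prescribed lengths; infinitely many symbols are independent outright.
--
-- In a finite monadic language a structure is determined, up to formulas of quantifier rank r,
-- by the sizes of its finitely many colour classes truncated at r + 1. If a sentence φ splits
-- into infinitely many pairwise inconsistent pieces, each with a model having d infinite
-- classes, then by pigeonhole one of these models also has a finite class too large for φ
-- to bound, and making it infinite yields a model of φ with d + 1 infinite classes. So the rank is
-- at most the number of colours plus one.

module Submission where

open import Defs
open import Axiom.ExcludedMiddle using (ExcludedMiddle)
open import Data.Bool.Base using (Bool; true; false; if_then_else_; _∧_)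
open import Data.Empty using (⊥; ⊥-elim)
open import Data.Fin.Base using (Fin; zero; suc; toℕ; inject≤; fromℕ<; combine; funToFin; finToFun)
open import Data.Fin.Properties as Fin using (finToFun-funToFin; injective⇒≤; <⇒notInjective; ℕ→Fin-notInjective; pigeonhole; toℕ-injective; toℕ-fromℕ<; inject≤-injective; +↔⊎)
open import Data.List.Base as List using (List; []; _∷_; length; filter; deduplicate)
open import Data.List.Membership.Propositional as List∈ using () renaming (_∈_ to _∈ₗ_; _∉_ to _∉ₗ_)
open import Data.List.Membership.Propositional.Properties using (∈-lookup; ∈-map⁺; ∈-map⁻; ∈-filter⁺; ∈-filter⁻; ∈-deduplicate⁺)
open import Data.List.Properties using (length-map; length-filter)
open import Data.List.Relation.Unary.All as All using (All; []; _∷_)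
open import Data.List.Relation.Unary.All.Properties as All using (¬Any⇒All¬)
open import Data.List.Relation.Unary.AllPairs as AllPairs using (AllPairs; []; _∷_)
open import Data.List.Relation.Unary.AllPairs.Properties as AllPairs using ()
open import Data.List.Relation.Unary.Any as Any using (here; there; index)
open import Data.List.Relation.Unary.Any.Properties using (lookup-index)
open import Data.List.Relation.Unary.Unique.DecPropositional.Properties using (deduplicate-!)
open import Data.List.Relation.Unary.Unique.Propositional using (Unique)
open import Data.Nat.Base using (ℕ; zero; suc; _+_; _^_; _⊔_; _≤_; _<_; z≤n; s≤s)
open import Data.Nat.Properties
open import Data.Product.Base using (Σ; ∃; _×_; _,_; proj₁; proj₂; swap; ∃-syntax)
open import Data.Product.Properties using (,-injectiveʳ)
open import Data.Sum.Base as Sum using (_⊎_; inj₁; inj₂)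
open import Data.Sum.Function.Propositional using (_⊎-↔_)
open import Data.Sum.Properties using (inj₁-injective; inj₂-injective)
open import Data.Vec.Base as Vec using (Vec; []; _∷_; lookup; replicate)
open import Data.Vec.Properties using (map-replicate)
open import Function.Base using (_∘_; id; const)
open import Function.Bundles using (Inverse; Injection; mk↔ₛ′)
open import Function.Construct.Composition using (_↔-∘_)
open import Function.Construct.Symmetry using (↔-sym)
open import Function.Definitions using (Injective)
open import Function.Properties.Inverse using (↔⇒↣)
open import Level using (0ℓ; Lift; lift; lower) renaming (suc to lsuc)
open import Relation.Binary.Definitions using (DecidableEquality; tri<; tri≈; tri>)
open import Relation.Binary.PropositionalEquality using (_≡_; _≢_; _≗_; refl; sym; trans; cong; cong₂; subst; ≢-sym)
open import Relation.Nullary.Decidable using (Dec; yes; no; does; map′; decidable-stable; toSum; dec-true; dec-false)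
open import Relation.Nullary.Negation.Core using (¬_; contradiction)
open import Relation.Unary using (_∈_; _≐_)

open Structure
open Theory

-- Finite functions, lists and the pigeonhole principle.

funToFin-cong : ∀ {m n} {f g : Fin m → Fin n} → f ≗ g → funToFin f ≡ funToFin g
funToFin-cong {zero}  f≗g = refl
funToFin-cong {suc m} f≗g = cong₂ combine (f≗g zero) (funToFin-cong (f≗g ∘ suc))

funToFin-injective : ∀ {m n} {f g : Fin m → Fin n} → funToFin f ≡ funToFin g → f ≗ g
funToFin-injective {f = f} {g} eq i =
  trans (sym (finToFun-funToFin f i)) (trans (cong (λ t → finToFun t i) eq) (finToFun-funToFin g i))

module _ {A : Set} where

  lookup-injective : ∀ {xs : List A} → Unique xs → Injective _≡_ _≡_ (List.lookup xs)
  lookup-injective (x∉xs ∷ xs!) {zero}  {zero}  eq = refl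
  lookup-injective (x∉xs ∷ xs!) {zero}  {suc j} eq = contradiction eq (All.lookup x∉xs (∈-lookup j))
  lookup-injective (x∉xs ∷ xs!) {suc i} {zero}  eq = contradiction (sym eq) (All.lookup x∉xs (∈-lookup i))
  lookup-injective (x∉xs ∷ xs!) {suc i} {suc j} eq = cong suc (lookup-injective xs! eq)

  AllPairs-lookup : ∀ {R : A → A → Set} → (∀ {x y} → R x y → R y x) → ∀ {xs x y} →
                    AllPairs R xs → x ∈ₗ xs → y ∈ₗ xs → x ≡ y ⊎ R x y
  AllPairs-lookup R-sym (_ ∷ _)   (here refl) (here refl) = inj₁ refl
  AllPairs-lookup R-sym (rs ∷ _)  (here refl) (there y∈)  = inj₂ (All.lookup rs y∈)
  AllPairs-lookup R-sym (rs ∷ _)  (there x∈)  (here refl) = inj₂ (R-sym (All.lookup rs x∈))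
  AllPairs-lookup R-sym (_ ∷ rss) (there x∈)  (there y∈)  = AllPairs-lookup R-sym rss x∈ y∈

  injection⇒Infinite : (f : ℕ → A) → Injective _≡_ _≡_ f → Infinite A
  injection⇒Infinite f f-inj (n , A↔Fin) =
    ℕ→Fin-notInjective (Inverse.to A↔Fin ∘ f) (f-inj ∘ Injection.injective (↔⇒↣ A↔Fin))

ℕ-pigeonhole : ∀ {n} (f : ℕ → Fin n) → ∃[ i ] ∃[ j ] i < j × f i ≡ f j
ℕ-pigeonhole {n} f = let (i , j , i<j , eq) = pigeonhole (n<1+n n) (f ∘ toℕ) in toℕ i , toℕ j , i<j , eq

Finite-⊎ : ∀ {A B} → Finite A → Finite B → Finite (A ⊎ B)
Finite-⊎ (m , A↔) (n , B↔) = m + n , (↔-sym (+↔⊎ {m} {n}) ↔-∘ (A↔ ⊎-↔ B↔))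

-- Classical tools.

module Classical (em : ExcludedMiddle (lsuc 0ℓ)) where

  -- Abstract because every decide P would otherwise unfold to em at a hidden type argument, and
  -- with-abstraction could not tell different P apart.
  abstract
    decide : (P : Set) → Dec P
    decide P = map′ lower lift (em {Lift (lsuc 0ℓ) P})

  stable : {P : Set} → ¬ ¬ P → P
  stable = decidable-stable (decide _)

  _≟ᶜ_ : {A : Set} → DecidableEquality A
  x ≟ᶜ y = decide (x ≡ y)

  -- Coding truth values in `Fin 2` lets `funToFin` turn a finite family of propositions into an
  -- element of a finite type.
  bit : Set → Fin 2
  bit P = if does (decide P) then suc zero else zero

  bit-cong : ∀ {P Q} → (P → Q) → (Q → P) → bit P ≡ bit Q
  bit-cong {P} {Q} to from with decide P | decide Q
  ... | yes _ | yes _ = refl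
  ... | yes p | no ¬q = contradiction (to p) ¬q
  ... | no ¬p | yes q = contradiction (from q) ¬p
  ... | no _  | no _  = refl

  bit-injective : ∀ {P Q} → bit P ≡ bit Q → P → Q
  bit-injective {P} {Q} eq p with decide P | decide Q
  ... | _     | yes q = q
  ... | no ¬p | no _  = contradiction p ¬p

  -- Otherwise the position of `f i` in `zs` would inject `Fin j` into a smaller finite set.
  fresh : ∀ {A : Set} {j} {f : Fin j → A} → Injective _≡_ _≡_ f →
          ∀ zs → length zs < j → ∃[ i ] f i ∉ₗ zs
  fresh {f = f} f-inj zs zs<j = stable λ none →
    let f∈zs : ∀ i → f i ∈ₗ zs
        f∈zs i = stable λ f∉ → none (i , f∉)
    in <⇒notInjective zs<j λ {i} {j} eq → f-inj
      (trans (lookup-index (f∈zs i)) (trans (cong (List.lookup zs) eq) (sym (lookup-index (f∈zs j)))))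

  covered⇒Finite : ∀ {A : Set} (xs : List A) → (∀ a → a ∈ₗ xs) → Finite A
  covered⇒Finite xs ∈xs = length ys , mk↔ₛ′ (index ∘ ∈ys) (List.lookup ys)
      (λ i → lookup-injective (deduplicate-! _≟ᶜ_ xs) (sym (lookup-index (∈ys _))))
      (λ a → sym (lookup-index (∈ys a)))
    where
    ys = deduplicate _≟ᶜ_ xs
    ∈ys : ∀ a → a ∈ₗ ys
    ∈ys a = ∈-deduplicate⁺ _≟ᶜ_ (∈xs a)

  -- Excluded middle for types, not just propositions, acts as a choice operator here.
  Infinite⇒sequence : ∀ {A} → Infinite A → Σ (ℕ → A) (Injective _≡_ _≡_)
  Infinite⇒sequence {A} infinite = s , s-injective
    where
    new : (xs : List A) → ∃[ a ] a ∉ₗ xs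
    new xs = stable λ none → infinite (covered⇒Finite xs λ a → stable λ a∉ → none (a , a∉))

    prefix : ℕ → List A
    prefix zero    = []
    prefix (suc n) = proj₁ (new (prefix n)) ∷ prefix n

    s : ℕ → A
    s n = proj₁ (new (prefix n))

    s∈prefix : ∀ {m n} → m < n → s m ∈ₗ prefix n
    s∈prefix {n = suc n} (s≤s m≤n) with m≤n⇒m<n∨m≡n m≤n
    ... | inj₁ m<n  = there (s∈prefix m<n)
    ... | inj₂ refl = here refl

    s-distinct : ∀ {m n} → m < n → s m ≢ s n
    s-distinct {n = n} m<n eq = proj₂ (new (prefix n)) (subst (_∈ₗ prefix n) eq (s∈prefix m<n))

    s-injective : Injective _≡_ _≡_ s
    s-injective {m} {n} eq with <-cmp m n
    ... | tri< m<n _ _ = contradiction eq (s-distinct m<n)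
    ... | tri≈ _ m≡n _ = m≡n
    ... | tri> _ _ n<m = contradiction (sym eq) (s-distinct n<m)

  theoryOf : ∀ {L} → Structure L → Theory L
  theoryOf M = record
    { sentences  = λ φ → M ⊨ φ
    ; consistent = M , λ _ → id
    ; complete   = λ φ → toSum (decide (M ⊨ φ))
    }

  -- Rank ∞

  record IndependentSentences (L : Language) : Set₁ where
    field
      ψ        : ℕ → Sentence L
      model    : (ℕ → Bool) → Structure L
      infinite : ∀ X → Infinite (Carrier (model X))
      true⇒⊨   : ∀ X i → X i ≡ true → model X ⊨ ψ i
      ⊨⇒true   : ∀ X i → model X ⊨ ψ i → X i ≡ true

  module _ {L} (I : IndependentSentences L) where
    open IndependentSentences I

    -- Among `ψ n`, `ψ (n + 1)`, ... the first to hold is `ψ (n + k)`. Uniqueness of the first turns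
    -- independent sentences into pairwise inconsistent ones.
    firstAt : ℕ → ℕ → Sentence L
    firstAt n zero    = ψ n
    firstAt n (suc k) = and (not (ψ n)) (firstAt (suc n) k)

    firstAt-inconsistent : ∀ n k l → k ≢ l → Inconsistent (firstAt n k) (firstAt n l)
    firstAt-inconsistent n zero    zero    k≢l _ = k≢l refl
    firstAt-inconsistent n zero    (suc l) k≢l (M , p , ¬p , _) = ¬p p
    firstAt-inconsistent n (suc k) zero    k≢l (M , (¬p , _) , p) = ¬p p
    firstAt-inconsistent n (suc k) (suc l) k≢l (M , (_ , p) , (_ , q)) =
      firstAt-inconsistent (suc n) k l (k≢l ∘ cong suc) (M , p , q)

    model⊨firstAt : ∀ n k X → (∀ i → n ≤ i → i < n + k → X i ≡ false) → X (n + k) ≡ true →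
                    model X ⊨ firstAt n k
    model⊨firstAt n zero    X fs t = true⇒⊨ X n (subst (λ i → X i ≡ true) (+-identityʳ n) t)
    model⊨firstAt n (suc k) X fs t rewrite +-suc n k =
      (λ p → contradiction (trans (sym (fs n ≤-refl (s≤s (m≤m+n n k)))) (⊨⇒true X n p)) λ ()) ,
      model⊨firstAt (suc n) k X (λ i n<i → fs i (<⇒≤ n<i)) t

    Agree : ℕ → (X Y : ℕ → Bool) → Set
    Agree n X Y = ∀ i → i < n → X i ≡ Y i

    -- An extension of the first `n` values of `p` whose model satisfies `firstAt n k`.
    branch : ℕ → ℕ → (ℕ → Bool) → ℕ → Bool
    branch n k p i = if does (i <? n) then p i else does (i ≟ n + k)

    branch-below : ∀ n k p → Agree n (branch n k p) p
    branch-below n k p i i<n rewrite dec-true (i <? n) i<n = refl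

    branch-false : ∀ n k p i → n ≤ i → i < n + k → branch n k p i ≡ false
    branch-false n k p i n≤i i<n+k rewrite dec-false (i <? n) (≤⇒≯ n≤i) = dec-false (i ≟ n + k) (<⇒≢ i<n+k)

    branch-true : ∀ n k p → branch n k p (n + k) ≡ true
    branch-true n k p rewrite dec-false (n + k <? n) (≤⇒≯ (m≤m+n n k)) = dec-true (n + k ≟ n + k) refl

    -- The invariant of the induction on ordinals: all patterns with one fixed finite prefix
    -- contribute their theories to `𝒯`.
    record Rich (𝒯 : Family L) : Set₁ where
      constructor mkRich
      field
        depth  : ℕ
        prefix : ℕ → Bool
        inside : ∀ X → Agree depth X prefix → theoryOf (model X) ∈ 𝒯

    open Rich using (depth)

    Rich-↾ : ∀ {𝒯} (r : Rich 𝒯) k → Rich (𝒯 ↾ firstAt (depth r) k)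
    -- The new prefix must reach past position `n + k`, where the pattern has to be true.
    Rich-↾ (mkRich n p inside) k = mkRich (suc (n + k)) (branch n k p) λ X agree →
      inside X (λ i i<n → trans (agree i (<-≤-trans i<n (m≤n⇒m≤1+n (m≤m+n n k)))) (branch-below n k p i i<n)) ,
      model⊨firstAt n k X
        (λ i n≤i i<n+k → trans (agree i (m<n⇒m<1+n i<n+k)) (branch-false n k p i n≤i i<n+k))
        (trans (agree (n + k) ≤-refl) (branch-true n k p))

    Rich⇒Nonempty : ∀ {𝒯} → Rich 𝒯 → NonemptyFamily 𝒯
    Rich⇒Nonempty (mkRich n p inside) = theoryOf (model p) , inside p λ _ _ → refl

    -- Choose a theory containing `firstAt n k` for each `k`. A list entry equal to two of these
    -- would have a model of two inconsistent sentences, so the positions in a covering list would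
    -- inject ℕ into a finite set.
    Rich⇒Infinite : ∀ {𝒯} → Rich 𝒯 → InfiniteFamily 𝒯
    Rich⇒Infinite {𝒯} rich@(mkRich n _ _) (Ts , cover) = ℕ→Fin-notInjective position position-injective
      where
      T : ∀ k → NonemptyFamily (𝒯 ↾ firstAt n k)
      T k = Rich⇒Nonempty (Rich-↾ rich k)

      covered : ∀ k → Any.Any (λ T′ → sentences (proj₁ (T k)) ≐ sentences T′) Ts
      covered k = cover (proj₁ (T k)) (proj₁ (proj₂ (T k)))

      position : ℕ → Fin (length Ts)
      position = index ∘ covered

      position-injective : Injective _≡_ _≡_ position
      position-injective {k} {l} eq = decidable-stable (k ≟ l) λ k≢l →
        let Tₖ⇒ = proj₁ (lookup-index (covered k))
            Tₗ⇐ = proj₂ (lookup-index (covered l))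
            (M , M⊨Tₗ) = consistent (proj₁ (T l))
            φₖ∈Tₗ = Tₗ⇐ (subst (λ i → firstAt n k ∈ sentences (List.lookup Ts i)) eq (Tₖ⇒ (proj₂ (proj₂ (T k)))))
        in firstAt-inconsistent n k l k≢l (M , M⊨Tₗ (firstAt n k) φₖ∈Tₗ , M⊨Tₗ (firstAt n l) (proj₂ (proj₂ (T l))))

    Rich⇒RS≡∞ : ∀ {𝒯} → Rich 𝒯 → 𝒯 RS≡∞
    Rich⇒RS≡∞ rich zero = Rich⇒Nonempty rich
    Rich⇒RS≡∞ rich (suc zero) = Rich⇒Infinite rich
    Rich⇒RS≡∞ rich@(mkRich n _ _) (suc (suc α)) =
      firstAt n , firstAt-inconsistent n , λ k → Rich⇒RS≡∞ (Rich-↾ rich k) (suc α)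
    Rich⇒RS≡∞ rich@(mkRich n _ _) (suc (sup J j₀ α)) =
      firstAt n , firstAt-inconsistent n , λ k → Rich⇒RS≡∞ (Rich-↾ rich k) (sup J j₀ α)
    Rich⇒RS≡∞ rich (sup J j₀ α) j = Rich⇒RS≡∞ rich (α j)

    𝒯∞-RS≡∞ : 𝒯∞ L RS≡∞
    𝒯∞-RS≡∞ = Rich⇒RS≡∞ (mkRich 0 (const false) λ X _ → model X , (λ _ → id) , infinite X)

  -- Coding a pattern by the lengths of chains.

  module Chains (L : Language) where
    open Language L

    -- For each n with X n there is a path (n , 1 + n) → … → (n , 1) → (n , 0) from a
    -- leaf to a fixed point; all other backward paths are infinite.
    next : (ℕ → Bool) → ℕ × ℕ → ℕ × ℕ
    next X (n , zero)  = n , zero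
    next X (n , suc j) = if X n ∧ does (j ≟ᶜ suc n) then (n , suc j) else (n , j)

    -- All predicates of arity at least 2 and all functions of arity at least 1 carry the same graph
    -- in their first arguments, so one structure serves whichever symbol is available.
    chains : (ℕ → Bool) → Structure L
    chains X = record { Carrier = ℕ × ℕ ; point = 0 , 0 ; relᴹ = λ _ → related ; funᴹ = λ _ → apply }
      where
      related : ∀ {k} → Vec (ℕ × ℕ) k → Set
      related (x ∷ y ∷ _) = next X x ≡ y
      related _           = ⊥

      apply : ∀ {k} → Vec (ℕ × ℕ) k → ℕ × ℕ
      apply []      = 0 , 0
      apply (x ∷ _) = next X x

    module _ (edge : ∀ {n} → Fin n → Fin n → Formula L n)
             (edge⁻ : ∀ X {n} (ρ : Vec _ n) x y → Holds (chains X) ρ (edge x y) → next X (lookup ρ x) ≡ lookup ρ y)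
             (edge⁺ : ∀ X {n} (ρ : Vec _ n) x y → next X (lookup ρ x) ≡ lookup ρ y → Holds (chains X) ρ (edge x y))
             where

      -- A leaf reaches `x` in `i` steps; the inequality keeps the path from idling at a fixed
      -- point.
      leafAbove : ∀ {n} → ℕ → Fin n → Formula L n
      leafAbove zero    x = not (exists (edge zero (suc x)))
      leafAbove (suc i) x = exists (and (edge zero (suc x)) (and (not (equal zero (suc x))) (leafAbove i zero)))

      -- Column `m` has a leaf only if `X m` is true, and that leaf is `(m , suc m)`; each step of
      -- the path descends by one.
      leafAbove⁻ : ∀ X i {n} (ρ : Vec _ n) x → Holds (chains X) ρ (leafAbove i x) →
                   let (m , j) = lookup ρ x in X m ≡ true × j + i ≡ suc m
      leafAbove⁻ X zero ρ x leaf with lookup ρ x in ρx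
      ... | m , j with X m in Xm | j ≟ᶜ suc m
      ...   | true  | yes refl = refl , +-identityʳ _
      ...   | true  | no j≢ = ⊥-elim (leaf ((m , suc j) , edge⁺ X _ zero (suc x) (trans eq (sym ρx))))
        where
        eq : next X (m , suc j) ≡ (m , j)
        eq rewrite Xm | dec-false (j ≟ᶜ suc m) j≢ = refl
      ...   | false | _     = ⊥-elim (leaf ((m , suc j) , edge⁺ X _ zero (suc x) (trans eq (sym ρx))))
        where
        eq : next X (m , suc j) ≡ (m , j)
        eq rewrite Xm = refl
      leafAbove⁻ X (suc i) ρ x (y@(m , l) , e , y≢x , leaf) with leafAbove⁻ X i (y ∷ ρ) zero leaf
      ... | Xm , l+i≡ with l | edge⁻ X (y ∷ ρ) zero (suc x) e
      ...   | zero   | eq = contradiction eq y≢x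
      ...   | suc l′ | eq with X m ∧ does (l′ ≟ᶜ suc m)
      ...     | true  = contradiction eq y≢x
      ...     | false rewrite sym eq = Xm , trans (+-suc l′ i) l+i≡

      leafAbove⁺ : ∀ X i {n} (ρ : Vec _ n) x {m j} → lookup ρ x ≡ (m , j) → X m ≡ true → j + i ≡ suc m →
                   Holds (chains X) ρ (leafAbove i x)
      leafAbove⁺ X zero ρ x {m} {j} ρx Xm j+0≡ (y , e) =
        noPreimage y (trans (edge⁻ X (y ∷ ρ) zero (suc x) e) (trans ρx (cong (m ,_) (trans (sym (+-identityʳ j)) j+0≡))))
        where
        -- The only candidate is `(m , 2 + m)`, which is a fixed point because `X m` is true.
        noPreimage : ∀ y → next X y ≢ (m , suc m)
        noPreimage (n , zero) ()
        noPreimage (n , suc l) eq with X n in Xn | l ≟ᶜ suc n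
        noPreimage (n , suc .(suc n)) () | true | yes refl
        noPreimage (n , suc l) refl | true  | no l≢ = l≢ refl
        noPreimage (n , suc l) refl | false | _     = contradiction (trans (sym Xn) Xm) λ ()
      leafAbove⁺ X (suc i) ρ x {m} {j} ρx Xm j+≡ =
        (m , suc j) , edge⁺ X _ zero (suc x) (trans step (sym ρx)) ,
        (λ eq → 1+n≢n (,-injectiveʳ (trans eq ρx))) ,
        leafAbove⁺ X i ((m , suc j) ∷ ρ) zero refl Xm (trans (sym (+-suc j i)) j+≡)
        where
        step : next X (m , suc j) ≡ (m , j)
        step rewrite Xm | dec-false (j ≟ᶜ suc m) (λ j≡ → m≢1+m+n j (trans j≡ (trans (sym j+≡) (+-suc j i)))) = refl

      chains-independent : IndependentSentences L
      chains-independent = record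
        -- The fixed point `(i , 0)` lies at distance `suc i` from its leaf. Distance 0 codes
        -- nothing, since a fixed point is its own preimage and so never a leaf.
        { ψ        = λ i → exists (and (edge zero zero) (leafAbove (suc i) zero))
        ; model    = chains
        ; infinite = λ X → injection⇒Infinite (0 ,_) ,-injectiveʳ
        ; true⇒⊨   = λ X i Xi → (i , 0) , edge⁺ X _ zero zero refl , leafAbove⁺ X (suc i) _ zero refl Xi refl
        ; ⊨⇒true   = λ { X i (x , e , leaf) → root X i x (edge⁻ X _ zero zero e) (leafAbove⁻ X (suc i) _ zero leaf) }
        }
        where
        root : ∀ X i ((m , j) : ℕ × ℕ) → next X (m , j) ≡ (m , j) → X m ≡ true × j + suc i ≡ suc m → X i ≡ true
        root X i (m , zero)  fixed (Xm , refl) = Xm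
        root X i (m , suc j) fixed (Xm , j+≡) with X m | j ≟ᶜ suc m
        -- The other fixed point `(m , 2 + m)` lies above the leaf of its column, against the height
        -- equation.
        ... | true  | yes refl = contradiction (sym (suc-injective j+≡)) (m≢1+m+n m)
        ... | true  | no _     = contradiction (sym (,-injectiveʳ fixed)) 1+n≢n
        ... | false | _        = contradiction (sym (,-injectiveʳ fixed)) 1+n≢n

    predicate-independent : ∀ {k} → PredSym (2 + k) → IndependentSentences L
    predicate-independent R = chains-independent (λ x y → rel R (x ∷ replicate _ y)) (λ _ _ _ _ → id) (λ _ _ _ _ → id)

    function-independent : ∀ {k} → FunSym (1 + k) → IndependentSentences L
    function-independent F = chains-independent (λ x y → graph F (replicate _ x) y) (λ _ _ _ _ → id) (λ _ _ _ _ → id)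

  -- Independence from infinitely many symbols.

  module _ {L : Language} where
    open Language L

    predicates-independent : (s : ℕ → ∃ PredSym) → Injective _≡_ _≡_ s → IndependentSentences L
    predicates-independent s s-inj = record
      { ψ        = λ i → exists (rel (proj₂ (s i)) (replicate _ zero))
      ; model    = λ X → record
          { Carrier = ℕ ; point = 0 ; funᴹ = λ _ _ → 0
          ; relᴹ = λ R _ → ∃[ i ] s i ≡ (_ , R) × X i ≡ true }
      ; infinite = λ _ → injection⇒Infinite id id
      ; true⇒⊨   = λ X i Xi → 0 , i , refl , Xi
      ; ⊨⇒true   = λ { X i (_ , j , sj≡si , Xj) → subst (λ i → X i ≡ true) (s-inj sj≡si) Xj }
      }

    -- A function symbol always has a value, so truth is coded by agreement with the reference
    -- symbol `s 0`, whose value is 0.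
    functions-independent : (s : ℕ → ∃ FunSym) → Injective _≡_ _≡_ s → IndependentSentences L
    functions-independent s s-inj = record
      { ψ        = λ i → exists (and (graph (proj₂ (s 0)) (replicate _ zero) zero)
                                     (graph (proj₂ (s (suc i))) (replicate _ zero) zero))
      ; model    = λ X → record
          { Carrier = ℕ ; point = 0 ; relᴹ = λ _ _ → ⊥
          ; funᴹ = λ F _ → value X (_ , F) }
      ; infinite = λ _ → injection⇒Infinite id id
      ; true⇒⊨   = λ X i Xi → 0 , value-0 X (inj₁ refl) , value-0 X (inj₂ (i , refl , Xi))
      ; ⊨⇒true   = λ { X i (_ , p , q) → value-0⁻ X i (trans q (trans (sym p) (value-0 X (inj₁ refl)))) }
      }
      where
      Zero : (ℕ → Bool) → ∃ FunSym → Set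
      Zero X F = s 0 ≡ F ⊎ ∃[ i ] s (suc i) ≡ F × X i ≡ true

      value : (ℕ → Bool) → ∃ FunSym → ℕ
      value X F = if does (decide (Zero X F)) then 0 else 1

      value-0 : ∀ X {F} → Zero X F → value X F ≡ 0
      value-0 X {F} z rewrite dec-true (decide (Zero X F)) z = refl

      value-0⁻ : ∀ X i → value X (s (suc i)) ≡ 0 → X i ≡ true
      value-0⁻ X i eq with decide (Zero X (s (suc i)))
      ... | yes (inj₁ s₀≡) = contradiction (s-inj s₀≡) λ ()
      ... | yes (inj₂ (j , sj≡ , Xj)) = subst (λ i → X i ≡ true) (suc-injective (s-inj sj≡)) Xj

    ¬FiniteMonadic⇒independent : ¬ FiniteMonadic L → IndependentSentences L
    ¬FiniteMonadic⇒independent ¬fm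
      with decide (∃[ m ] 2 ≤ m × PredSym m) | decide (∃[ n ] 1 ≤ n × FunSym n)
         | decide (Finite (∃ PredSym)) | decide (Finite (∃ FunSym))
    ... | yes (_ , s≤s (s≤s _) , R) | _ | _ | _ = Chains.predicate-independent L R
    ... | _ | yes (_ , s≤s _ , F) | _ | _ = Chains.function-independent L F
    ... | _ | _ | no inf | _ = let (s , s-inj) = Infinite⇒sequence inf in predicates-independent s s-inj
    ... | _ | _ | _ | no inf = let (s , s-inj) = Infinite⇒sequence inf in functions-independent s s-inj
    ... | no ¬R | no ¬F | yes finP | yes finF = contradiction (Finite-⊎ finP finF , ¬R , ¬F) ¬fm

  -- Finite monadic languages

  quantifierRank : ∀ {L n} → Formula L n → ℕ
  quantifierRank (equal x y)    = 0
  quantifierRank (rel R xs)     = 0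
  quantifierRank (graph F xs y) = 0
  quantifierRank (not φ)        = quantifierRank φ
  quantifierRank (and φ ψ)      = quantifierRank φ ⊔ quantifierRank ψ
  quantifierRank (exists φ)     = suc (quantifierRank φ)

  module Monadic {L : Language} (fm : FiniteMonadic L) where
    open Language L

    Symbol : Set
    Symbol = ∃ PredSym ⊎ ∃ FunSym

    symbolCount : ℕ
    symbolCount = proj₁ (proj₁ fm)

    open Inverse (proj₂ (proj₁ fm)) using () renaming (to to code; from to symbol; strictlyInverseʳ to symbol-code)

    nonunary : ∀ {k} → ¬ PredSym (2 + k)
    nonunary R = proj₁ (proj₂ fm) (_ , s≤s (s≤s z≤n) , R)

    nonconstant : ∀ {k} → ¬ FunSym (1 + k)
    nonconstant F = proj₂ (proj₂ fm) (_ , s≤s z≤n , F)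

    -- A nullary predicate is treated as a unary one that holds everywhere or nowhere, and
    -- a constant as the unary predicate of being equal to it.
    Sat : ∀ M → Symbol → Carrier M → Set
    Sat M (inj₁ (k , R)) a = relᴹ M R (replicate k a)
    Sat M (inj₂ (k , F)) a = funᴹ M F (replicate k a) ≡ a

    colourCount : ℕ
    colourCount = 2 ^ symbolCount

    Colour : Set
    Colour = Fin colourCount

    -- The atomic type of a point, coded as a number so that colours can be counted.
    colour : ∀ M → Carrier M → Colour
    colour M a = funToFin λ i → bit (Sat M (symbol i) a)

    colour⇒Sat : ∀ M N {a b} → colour M a ≡ colour N b → ∀ s → Sat M s a → Sat N s b
    colour⇒Sat M N {a} {b} eq s = subst (λ s → Sat M s a → Sat N s b) (symbol-code s)
      (bit-injective (funToFin-injective eq (code s)))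

    colour-cong : ∀ M N {a b} → (∀ s → Sat M s a → Sat N s b) → (∀ s → Sat N s b → Sat M s a) →
                  colour M a ≡ colour N b
    colour-cong M N to from = funToFin-cong λ i → bit-cong (to (symbol i)) (from (symbol i))

    -- Back-and-forth between structures with similar class sizes.

    AtLeast : Structure L → Colour → ℕ → Set
    AtLeast M c j = Σ (Fin j → Carrier M) λ f → Injective _≡_ _≡_ f × (∀ i → colour M (f i) ≡ c)

    AtLeast-mono : ∀ M {c i j} → i ≤ j → AtLeast M c j → AtLeast M c i
    AtLeast-mono M i≤j (f , f-inj , f-c) =
      (λ x → f (inject≤ x i≤j)) , (λ eq → inject≤-injective i≤j i≤j _ _ (f-inj eq)) , λ x → f-c (inject≤ x i≤j)

    -- Equality of class sizes truncated at `r`, under which the duplicator survives `r` rounds of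
    -- the Ehrenfeucht-Fraïssé game.
    Match : ℕ → Structure L → Structure L → Set
    Match r M N = ∀ c j → j ≤ r → (AtLeast M c j → AtLeast N c j) × (AtLeast N c j → AtLeast M c j)

    Match-sym : ∀ {r} M N → Match r M N → Match r N M
    Match-sym M N match c j j≤r = swap (match c j j≤r)

    record PartialIso (M N : Structure L) (ps : List (Carrier M × Carrier N)) : Set where
      field
        coloured : All (λ (a , b) → colour M a ≡ colour N b) ps
        distinct : AllPairs (λ (a , b) (a′ , b′) → a ≢ a′ × b ≢ b′) ps

    open PartialIso

    PartialIso-swap : ∀ {M N ps} → PartialIso M N ps → PartialIso N M (List.map swap ps)
    PartialIso-swap iso = record
      { coloured = All.map⁺ (All.map sym (coloured iso))
      ; distinct = AllPairs.map⁺ (AllPairs.map swap (distinct iso))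
      }

    PartialIso-functional : ∀ {M N ps a b a′ b′} → PartialIso M N ps →
                            (a , b) ∈ₗ ps → (a′ , b′) ∈ₗ ps → a ≡ a′ → b ≡ b′
    PartialIso-functional iso p∈ p′∈ a≡a′
      with AllPairs-lookup (λ (a≢ , b≢) → ≢-sym a≢ , ≢-sym b≢) (distinct iso) p∈ p′∈
    ... | inj₁ refl      = refl
    ... | inj₂ (a≢ , _) = contradiction a≡a′ a≢

    -- Together with `a`, the played points of its colour number at most `r`, so `N` has as many
    -- points of this colour. One of them differs from the fewer images of that colour, and images
    -- of other colours cannot clash with it.
    PartialIso-image : ∀ {r M N ps a} → Match r M N → PartialIso M N ps → length ps < r →
                       a ∉ₗ List.map proj₁ ps →
                       ∃[ b ] colour M a ≡ colour N b × b ∉ₗ List.map proj₂ ps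
    PartialIso-image {r} {M} {N} {ps} {a} match iso ps<r a∉ = f i , sym (f-c i) , fi∉
      where
      c : Colour
      c = colour M a

      sameColour? : ∀ p → Dec (colour M (proj₁ p) ≡ c)
      sameColour? p = colour M (proj₁ p) Fin.≟ c

      qs : List (Carrier M × Carrier N)
      qs = filter sameColour? ps

      as : List (Carrier M)
      as = a ∷ List.map proj₁ qs

      a∉qs : a ∉ₗ List.map proj₁ qs
      a∉qs a∈ with ∈-map⁻ proj₁ a∈
      ... | p , p∈ , refl = a∉ (∈-map⁺ proj₁ (proj₁ (∈-filter⁻ sameColour? p∈)))

      as! : Unique as
      as! = ¬Any⇒All¬ _ a∉qs ∷
            AllPairs.map⁺ (AllPairs.map proj₁ (AllPairs.filter⁺ sameColour? (distinct iso)))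

      as-c : All (λ x → colour M x ≡ c) as
      as-c = refl ∷ All.map⁺ (All.all-filter sameColour? ps)

      as≤r : length as ≤ r
      as≤r = ≤-trans (s≤s (≤-trans (≤-reflexive (length-map proj₁ qs)) (length-filter sameColour? ps))) ps<r

      inN : AtLeast N c (length as)
      inN = proj₁ (match c (length as) as≤r)
        (List.lookup as , lookup-injective as! , λ i → All.lookup as-c (∈-lookup i))

      f : Fin (length as) → Carrier N
      f = proj₁ inN

      f-c : ∀ i → colour N (f i) ≡ c
      f-c = proj₂ (proj₂ inN)

      unused : ∃[ i ] f i ∉ₗ List.map proj₂ qs
      unused = fresh (proj₁ (proj₂ inN)) (List.map proj₂ qs)
        (s≤s (≤-reflexive (trans (length-map proj₂ qs) (sym (length-map proj₁ qs)))))

      i : Fin (length as)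
      i = proj₁ unused

      fi∉ : f i ∉ₗ List.map proj₂ ps
      fi∉ fi∈ = let (p , p∈ , fi≡) = ∈-map⁻ proj₂ fi∈ in proj₂ unused (subst (_∈ₗ List.map proj₂ qs) (sym fi≡)
        (∈-map⁺ proj₂ (∈-filter⁺ sameColour? p∈
          (trans (All.lookup (coloured iso) p∈) (trans (cong (colour N) (sym fi≡)) (f-c i))))))

    -- The points a₀ and b₀ transfer the nullary predicates when ps is empty.
    transfer : ∀ {r M N ps n} (φ : Formula L n) {a₀ b₀} → colour M a₀ ≡ colour N b₀ →
               Match r M N → PartialIso M N ps →
               (ρ : Vec (Carrier M) n) (σ : Vec (Carrier N) n) → (∀ i → (lookup ρ i , lookup σ i) ∈ₗ ps) →
               length ps + quantifierRank φ ≤ r → Holds M ρ φ → Holds N σ φ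
    transfer (equal x y) c₀ match iso ρ σ env r≥ = PartialIso-functional iso (env x) (env y)
    transfer {M = M} {N} (rel R []) c₀ match iso ρ σ env r≥ = colour⇒Sat M N c₀ (inj₁ (_ , R))
    transfer {M = M} {N} (rel R (x ∷ [])) c₀ match iso ρ σ env r≥ =
      colour⇒Sat M N (All.lookup (coloured iso) (env x)) (inj₁ (_ , R))
    transfer (rel R (_ ∷ _ ∷ _)) = ⊥-elim (nonunary R)
    transfer {M = M} {N} (graph F [] y) c₀ match iso ρ σ env r≥ =
      colour⇒Sat M N (All.lookup (coloured iso) (env y)) (inj₂ (_ , F))
    transfer (graph F (_ ∷ _) y) = ⊥-elim (nonconstant F)
    transfer {M = M} {N} {ps} (not φ) c₀ match iso ρ σ env r≥ ¬φ = ¬φ ∘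
      transfer φ (sym c₀) (Match-sym M N match) (PartialIso-swap iso) σ ρ (∈-map⁺ swap ∘ env)
        (≤-trans (≤-reflexive (cong (_+ quantifierRank φ) (length-map swap ps))) r≥)
    transfer {ps = ps} (and φ ψ) c₀ match iso ρ σ env r≥ (p , q) =
      transfer φ c₀ match iso ρ σ env (≤-trans (+-monoʳ-≤ (length ps) (m≤m⊔n _ _)) r≥) p ,
      transfer ψ c₀ match iso ρ σ env (≤-trans (+-monoʳ-≤ (length ps) (m≤n⊔m _ _)) r≥) q
    transfer {M = M} {N} {ps} (exists φ) c₀ match iso ρ σ env r≥ (a , p)
      with decide (a ∈ₗ List.map proj₁ ps)
    ... | yes a∈ with ∈-map⁻ proj₁ a∈
    ...   | (_ , b) , ab∈ , refl =
      b , transfer φ c₀ match iso (a ∷ ρ) (b ∷ σ) (λ { zero → ab∈ ; (suc i) → env i })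
            (≤-trans (+-monoʳ-≤ (length ps) (n≤1+n _)) r≥) p
    transfer {M = M} {N} {ps} (exists φ) c₀ match iso ρ σ env r≥ (a , p) | no a∉ =
      let r>      = ≤-trans (≤-reflexive (sym (+-suc (length ps) (quantifierRank φ)))) r≥
          b , a~b , b∉ = PartialIso-image match iso (m+n≤o⇒m≤o _ r>) a∉
          iso′    = record
            { coloured = a~b ∷ coloured iso
            ; distinct = All.zip (All.map⁻ (¬Any⇒All¬ _ a∉) , All.map⁻ (¬Any⇒All¬ _ b∉)) ∷ distinct iso }
      in b , transfer φ c₀ match iso′ (a ∷ ρ) (b ∷ σ) (λ { zero → here refl ; (suc i) → there (env i) }) r> p

    -- The extra unit in `suc r` ensures, even for `r = 0`, that `N` realises the colour of
    -- `point M`; this settles the nullary predicates.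
    Match⇒⊨ : ∀ {r} M N → Match (suc r) M N → ∀ φ → quantifierRank φ ≤ r → M ⊨ φ → N ⊨ φ
    Match⇒⊨ M N match φ φ≤r =
      let (f , _ , f-c) = proj₁ (match (colour M (point M)) 1 (s≤s z≤n))
            ((λ _ → point M) , (λ { {zero} {zero} _ → refl }) , λ _ → refl)
      in transfer φ (sym (f-c zero)) match (record { coloured = [] ; distinct = [] }) [] [] (λ ()) (m≤n⇒m≤1+n φ≤r)

    -- Making a colour class infinite.

    Unbounded : Structure L → Colour → Set
    Unbounded M c = ∀ j → AtLeast M c j

    -- Countably many copies of `f zero` are added. The bound `2 + q` serves twice: two distinct
    -- points of colour `c` show that no constant has this colour, and class sizes stay the same up
    -- to `2 + q`.
    module Inflate (M : Structure L) (c : Colour) (q : ℕ) (many : AtLeast M c (2 + q)) where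

      f : Fin (2 + q) → Carrier M
      f = proj₁ many

      collapse : Carrier M ⊎ ℕ → Carrier M
      collapse = Sum.[ id , (λ _ → f zero) ]

      inflated : Structure L
      inflated = record
        { Carrier = Carrier M ⊎ ℕ
        ; point   = inj₁ (point M)
        ; relᴹ    = λ R xs → relᴹ M R (Vec.map collapse xs)
        ; funᴹ    = λ F xs → inj₁ (funᴹ M F (Vec.map collapse xs))
        }

      Sat⁺ : ∀ s x → Sat inflated s x → Sat M s (collapse x)
      Sat⁺ (inj₁ (k , R)) x = subst (relᴹ M R) (map-replicate collapse x k)
      Sat⁺ (inj₂ (k , F)) (inj₁ a) eq =
        trans (cong (funᴹ M F) (sym (map-replicate collapse (inj₁ a) k))) (inj₁-injective eq)

      -- A constant is never equal to a new point: the old points f 0 and f 1 of its colour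
      -- would both be the value of that constant.
      Sat⁻ : ∀ s x → Sat M s (collapse x) → Sat inflated s x
      Sat⁻ (inj₁ (k , R)) x = subst (relᴹ M R) (sym (map-replicate collapse x k))
      Sat⁻ (inj₂ (k , F)) (inj₁ a) eq =
        cong inj₁ (trans (cong (funᴹ M F) (map-replicate collapse (inj₁ a) k)) eq)
      Sat⁻ (inj₂ (suc _ , F)) (inj₂ _) eq = ⊥-elim (nonconstant F)
      Sat⁻ (inj₂ (zero , F))  (inj₂ _) eq = contradiction
        (proj₁ (proj₂ many) (trans (sym eq) (colour⇒Sat M M
          (trans (proj₂ (proj₂ many) zero) (sym (proj₂ (proj₂ many) (suc zero)))) (inj₂ (zero , F)) eq))) λ ()

      colour-inflated : ∀ x → colour inflated x ≡ colour M (collapse x)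
      colour-inflated x = colour-cong inflated M (λ s → Sat⁺ s x) (λ s → Sat⁻ s x)

      AtLeast⁺ : ∀ c′ j → AtLeast M c′ j → AtLeast inflated c′ j
      AtLeast⁺ c′ j (g , g-inj , g-c) =
        inj₁ ∘ g , g-inj ∘ inj₁-injective , λ i → trans (colour-inflated (inj₁ (g i))) (g-c i)

      inflated-unbounded : Unbounded inflated c
      inflated-unbounded j =
        inj₂ ∘ toℕ , toℕ-injective ∘ inj₂-injective , λ i → trans (colour-inflated (inj₂ (toℕ i))) (proj₂ (proj₂ many) zero)

      collapse-injective : ∀ x y → colour M (collapse x) ≢ c → colour M (collapse y) ≢ c →
                           collapse x ≡ collapse y → x ≡ y
      collapse-injective (inj₁ a) (inj₁ b) _ _ eq = cong inj₁ eq
      collapse-injective (inj₂ _) _ x≢c _ _ = contradiction (proj₂ (proj₂ many) zero) x≢c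
      collapse-injective (inj₁ _) (inj₂ _) _ y≢c _ = contradiction (proj₂ (proj₂ many) zero) y≢c

      -- The class of `c` already has `2 + q` points in `M`, and every other class contains old
      -- points only.
      AtLeast⁻ : ∀ c′ j → j ≤ 2 + q → AtLeast inflated c′ j → AtLeast M c′ j
      AtLeast⁻ c′ j j≤ (g , g-inj , g-c) with c′ Fin.≟ c
      ... | yes refl = AtLeast-mono M j≤ many
      ... | no c′≢c  = collapse ∘ g , (λ eq → g-inj (collapse-injective _ _ (g≢c _) (g≢c _) eq)) , g-c′
        where
        g-c′ : ∀ i → colour M (collapse (g i)) ≡ c′
        g-c′ i = trans (sym (colour-inflated (g i))) (g-c i)
        g≢c : ∀ i → colour M (collapse (g i)) ≢ c
        g≢c i eq = c′≢c (trans (sym (g-c′ i)) eq)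

      inflated-match : Match (2 + q) M inflated
      inflated-match c′ j j≤ = AtLeast⁺ c′ j , AtLeast⁻ c′ j j≤

    -- Profiles and saturated structures.

    counts : ∀ q → Structure L → Colour → Fin (suc q) → Fin 2
    counts q M c j = bit (AtLeast M c (toℕ j))

    -- All class sizes truncated at `q`, recorded in a finite type for the pigeonhole principle.
    profile : ∀ q → Structure L → Fin ((2 ^ suc q) ^ colourCount)
    profile q M = funToFin λ c → funToFin (counts q M c)

    profile⇒AtLeast : ∀ {q} M N → profile q M ≡ profile q N → ∀ c j → j ≤ q → AtLeast M c j → AtLeast N c j
    profile⇒AtLeast {q} M N eq c j j≤q =
      subst (λ j → AtLeast M c j → AtLeast N c j) (toℕ-fromℕ< (s≤s j≤q)) (bit-injective (counts-eq (fromℕ< (s≤s j≤q))))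
      where
      counts-eq : counts q M c ≗ counts q N c
      counts-eq = funToFin-injective {f = counts q M c} {counts q N c}
        (funToFin-injective {f = λ c → funToFin (counts q M c)} {λ c → funToFin (counts q N c)} eq c)

    -- No class has a finite size of `q` or more, so sizes truncated at `q` determine every
    -- `AtLeast M c j`.
    Saturated : ℕ → Structure L → Set
    Saturated q M = ∀ c → AtLeast M c q → Unbounded M c

    Saturated⇒AtLeast : ∀ {q} M N → profile q M ≡ profile q N → Saturated q N →
                        ∀ c j → AtLeast M c j → AtLeast N c j
    Saturated⇒AtLeast {q} M N eq sat c j atLeast with ≤-total j q
    ... | inj₁ j≤q = profile⇒AtLeast M N eq c j j≤q atLeast
    ... | inj₂ q≤j = sat c (profile⇒AtLeast M N eq c q ≤-refl (AtLeast-mono M q≤j atLeast)) j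

    Saturated⇒Match : ∀ {q} M N → profile q M ≡ profile q N → Saturated q M → Saturated q N → ∀ r → Match r M N
    Saturated⇒Match M N eq satM satN r c j _ = Saturated⇒AtLeast M N eq satN c j , Saturated⇒AtLeast N M (sym eq) satM c j

    -- Two of the structures share a profile; being saturated, they match at every size, hence at
    -- every quantifier rank.
    Saturated-collision : ∀ {q} (M : ℕ → Structure L) → (∀ k → Saturated q (M k)) →
                          ∃[ k ] ∃[ l ] k < l × ∀ φ → M k ⊨ φ → M l ⊨ φ
    Saturated-collision {q} M sat =
      let (k , l , k<l , eq) = ℕ-pigeonhole (profile q ∘ M)
      in k , l , k<l , λ φ →
           Match⇒⊨ (M k) (M l) (Saturated⇒Match (M k) (M l) eq (sat k) (sat l) _) φ ≤-refl

    -- Bounding the rank by the number of infinite classes.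

    Wide : ℕ → Structure L → Set
    Wide d M = Σ (Fin d → Colour) λ f → Injective _≡_ _≡_ f × (∀ i → Unbounded M (f i))

    Wide-inflate : ∀ {d} M (φ : Sentence L) c → AtLeast M c (2 + quantifierRank φ) → ¬ Unbounded M c →
                   M ⊨ φ → Wide d M → ∃[ N ] N ⊨ φ × Wide (suc d) N
    Wide-inflate {d} M φ c many bounded M⊨φ (f , f-inj , f-unbounded) =
      inflated , Match⇒⊨ M inflated (inflated-match) φ (n≤1+n _) M⊨φ , g , (λ {i} {j} → g-inj i j) , g-unbounded
      where
      open Inflate M c (quantifierRank φ) many hiding (f)

      f≢c : ∀ i → f i ≢ c
      f≢c i eq = bounded (subst (Unbounded M) eq (f-unbounded i))

      g : Fin (suc d) → Colour
      g zero    = c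
      g (suc i) = f i

      g-inj : ∀ i j → g i ≡ g j → i ≡ j
      g-inj zero    zero    _  = refl
      g-inj zero    (suc j) eq = contradiction (sym eq) (f≢c j)
      g-inj (suc i) zero    eq = contradiction eq (f≢c i)
      g-inj (suc i) (suc j) eq = cong suc (f-inj eq)

      g-unbounded : ∀ i → Unbounded inflated (g i)
      g-unbounded zero    = inflated-unbounded
      g-unbounded (suc i) = λ j → AtLeast⁺ (f i) j (f-unbounded i j)

    -- Induction on `d`, with `φ` collecting the splitting sentences. If no model of `φ` had `suc d`
    -- infinite classes, the models of the pieces would all be saturated, and two of them would
    -- satisfy the same sentences despite the inconsistency of the pieces.
    RS≥⇒Wide : ∀ d {𝒯 : Family L} (φ : Sentence L) → (∀ T → T ∈ 𝒯 → ∀ M → M ⊨ᵀ sentences T → M ⊨ φ) →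
               𝒯 RS≥ fromℕ (suc d) → ∃[ M ] M ⊨ φ × Wide d M
    RS≥⇒Wide zero {𝒯} φ 𝒯⊨φ infinite =
      -- An empty family would be covered by the empty list.
      let (T , T∈𝒯) = decidable-stable em λ empty → infinite ([] , λ T T∈𝒯 → contradiction (T , T∈𝒯) empty)
          (M , M⊨T) = consistent T
      in M , 𝒯⊨φ T T∈𝒯 M M⊨T , (λ ()) , (λ { {()} }) , λ ()
    RS≥⇒Wide (suc d) {𝒯} φ 𝒯⊨φ (ψ , ψ-inconsistent , 𝒯↾ψ) = decidable-stable em λ none →
      let (k , l , k<l , k≼l) = Saturated-collision (proj₁ ∘ model) (saturated none)
      in ψ-inconsistent k l (<⇒≢ k<l)
           (proj₁ (model l) , k≼l (ψ k) (proj₂ (proj₁ (proj₂ (model k)))) , proj₂ (proj₁ (proj₂ (model l))))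
      where
      model : ∀ k → ∃[ M ] M ⊨ and φ (ψ k) × Wide d M
      model k = RS≥⇒Wide d (and φ (ψ k))
        (λ T (T∈𝒯 , ψₖ∈T) M M⊨T → 𝒯⊨φ T T∈𝒯 M M⊨T , M⊨T (ψ k) ψₖ∈T) (𝒯↾ψ k)

      -- Inflation has to preserve only `φ`, not `ψ k`, so one threshold serves all `k`; the
      -- pigeonhole argument depends on this uniformity.
      saturated : ¬ (∃[ N ] N ⊨ φ × Wide (suc d) N) → ∀ k → Saturated (2 + quantifierRank φ) (proj₁ (model k))
      saturated none k c many = stable λ bounded →
        let (M , (M⊨φ , _) , wide) = model k in none (Wide-inflate M φ c many bounded M⊨φ wide)

    Wide⇒≤ : ∀ {d} M → Wide d M → d ≤ colourCount
    Wide⇒≤ M (_ , f-inj , _) = injective⇒≤ f-inj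

    RS-bounded : ∀ (𝒯 : Family L) → ¬ 𝒯 RS≥ fromℕ (2 + colourCount)
    RS-bounded 𝒯 rs =
      -- A valid sentence starts the induction; the resulting model has more infinite classes than
      -- there are colours.
      let (M , _ , wide) = RS≥⇒Wide (suc colourCount) {𝒯} (exists (equal zero zero)) (λ _ _ M _ → point M , refl) rs
      in 1+n≰n (Wide⇒≤ M wide)

  𝒯∞-nonempty : ∀ L → NonemptyFamily (𝒯∞ L)
  𝒯∞-nonempty L = theoryOf M , M , (λ _ → id) , injection⇒Infinite id id
    where
    M : Structure L
    M = record { Carrier = ℕ ; point = 0 ; relᴹ = λ _ _ → ⊥ ; funᴹ = λ _ _ → 0 }

  -- Descending from a rank bound that fails, the first one that holds is the rank; nonemptiness
  -- stops the descent at 0.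
  finite-rank : ∀ {L} (𝒯 : Family L) n → NonemptyFamily 𝒯 → ¬ 𝒯 RS≥ fromℕ n → ∃[ n ] 𝒯 RS≡ fromℕ n
  finite-rank 𝒯 zero nonempty ¬rs = contradiction nonempty ¬rs
  finite-rank 𝒯 (suc n) nonempty ¬rs with em {𝒯 RS≥ fromℕ n}
  ... | yes rs = n , rs , ¬rs
  ... | no ¬rs′ = finite-rank 𝒯 n nonempty ¬rs′

theorem3p2 : ExcludedMiddle (lsuc 0ℓ) →
    (L : Language) →
    (FiniteMonadic L → ∃[ n ] 𝒯∞ L RS≡ fromℕ n) ×
    (¬ FiniteMonadic L → 𝒯∞ L RS≡∞)
theorem3p2 em L =
  (λ fm → finite-rank (𝒯∞ L) (2 + Monadic.colourCount fm) (𝒯∞-nonempty L) (Monadic.RS-bounded fm (𝒯∞ L))) ,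
  (λ ¬fm → 𝒯∞-RS≡∞ (¬FiniteMonadic⇒independent ¬fm))
  where open Classical em
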